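{- For every prime $p$ and every integer $n \ge 2$, the equation $$x_1 + p x_2 + \cdots + p^{n-2} x_{n-1} - p^{n-1} x_n = 0, \quad\text{i.e.}\quad \sum_{i=1}^{n-1} p^{i-1} x_i = p^{n-1} x_n,$$ in the $n$ variables $x_1, \dots, x_n$ is $(n-1)$-regular but not $n$-regular.
   Context: $\mathbb{N}$ denotes the set of positive integers. For a positive integer $r$, an $r$-coloring of the positive integers is any function $C : \mathbb{N} \to \{1, \dots, r\}$. A linear homogeneous equation $a_1 x_1 + \cdots + a_n x_n = 0$ (with all $a_i$ nonzero integers) is called $r$-regular if for every $r$-coloring $C$ of the positive integers there is a monochromatic solution, i.e. positive integers $x_1, \dots, x_n$ (not necessarily distinct) satisfying the equation with $C(x_1) = \cdots = C(x_n)$. -}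

module Defs where

open import Data.Bool.Base using (if_then_else_; true; false)
open import Data.Fin.Base using (Fin; toℕ)
open import Data.Integer.Base as ℤ using (ℤ; +_; -_; 0ℤ)
open import Data.Integer.Properties using (+-0-commutativeMonoid; ∣-i∣≡∣i∣)
open import Data.Nat.Base using (ℕ; suc; _^_; NonZero)
open import Data.Nat.Properties using (_≟_; m^n≢0)
open import Data.Product.Base using (_×_; ∃-syntax)
open import Data.Refinement.Base using (Refinement-syntax; value)
open import Data.Vec.Functional using (Vector)
open import Relation.Binary.PropositionalEquality using (_≡_; sym; subst)
open import Relation.Nullary.Decidable.Core using (does)
open import Algebra.Properties.CommutativeMonoid.Sum +-0-commutativeMonoid
  using (sum)

ℕ⁺ : Set
ℕ⁺ = [ n ∈ ℕ ∣ NonZero n ]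

Coloring : ℕ → Set
Coloring r = ℕ⁺ → Fin r

record LinearEquation (n : ℕ) : Set where
  field
    coeff         : Vector ℤ n
    coeff-nonZero : ∀ i → ℤ.NonZero (coeff i)

open LinearEquation public

IsSolution : ∀ {n} → LinearEquation n → Vector ℕ⁺ n → Set
IsSolution E x = sum (λ i → coeff E i ℤ.* + value (x i)) ≡ 0ℤ

Monochromatic : ∀ {r n} → Coloring r → Vector ℕ⁺ n → Set
Monochromatic C x = ∀ i j → C (x i) ≡ C (x j)

Regular : ℕ → ∀ {n} → LinearEquation n → Set
Regular r {n} E =
  (C : Coloring r) → ∃[ x ] IsSolution {n} E x × Monochromatic C x

-- Indices start at 0, so the variable at index i has coefficient pⁱ, except
-- that the last one (i = n - 1) has coefficient - pⁿ⁻¹.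
powerCoeff : ℕ → (n : ℕ) → Vector ℤ n
powerCoeff p n i =
  if does (suc (toℕ i) ≟ n) then - (+ (p ^ toℕ i)) else + (p ^ toℕ i)

powerCoeff-nonZero : ∀ p .{{_ : NonZero p}} n i → ℤ.NonZero (powerCoeff p n i)
powerCoeff-nonZero p n i with does (suc (toℕ i) ≟ n)
... | true  = subst NonZero (sym (∣-i∣≡∣i∣ (+ (p ^ toℕ i)))) (m^n≢0 p (toℕ i))
... | false = m^n≢0 p (toℕ i)

powerEquation : (p : ℕ) .{{_ : NonZero p}} (n : ℕ) → LinearEquation n
powerEquation p n = record
  { coeff         = powerCoeff p n
  ; coeff-nonZero = powerCoeff-nonZero p n
  }

{-# OPTIONS --safe #-}
module Submission where

-- Write m = n - 1, so that the equation is Σ_{i<m} pⁱ xᵢ = pᵐ xₘ.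
--
-- m-regularity.  Among the m + 1 colours of x, p x, …, pᵐ x two agree, say
-- those of pⁱ x and pʲ x with i < j.  Put k = m - (j - i) and let S be the sum
-- of the pˡ with l < m, l ≠ k.  If x, y = x + S w and z = pᵐ w all have the same
-- vector of m + 1 colours, then x_k = pʲ x, xₘ = pⁱ y and pⁱ z for all other
-- variables is a monochromatic solution, since k + j = m + i.  Such x and w
-- exist by a Brauer-type theorem in which S may depend on the colour, obtained
-- by iterating van der Waerden's theorem.
--
-- Failure of (m + 1)-regularity.  Colour x by its p-adic valuation modulo n.
-- In a monochromatic solution the terms have pairwise distinct valuations, so
-- they cannot cancel: by induction on E, every term is divisible by p ^ E.

open import Defs
open import Data.Fin.Base as Fin
  using (Fin; zero; suc; toℕ; fromℕ; fromℕ<; punchIn; funToFin; finToFun)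
open import Data.Fin.Properties
  using (pigeonhole; finToFun-funToFin; toℕ-fromℕ<; toℕ-fromℕ; toℕ<n; toℕ-injective;
         punchInᵢ≢i)
open import Data.Integer.Base as ℤ using (ℤ; +_; 0ℤ)
open import Data.Integer.Divisibility.Signed as ℤ∣ using () renaming (_∣_ to _∣ℤ_)
import Data.Integer.Properties as ℤ
open import Data.Irrelevant using ([_])
open import Data.Nat.Base
open import Data.Nat.Divisibility
open import Data.Nat.DivMod
  using (_mod_; m≡m%n+[m/n]*n; [m+kn]%n≡m%n; m<n⇒m%n≡m; m%n<n)
open import Data.Nat.Primality using (Prime; prime⇒nonZero; prime⇒nonTrivial)
open import Data.Nat.Properties
open import Data.Nat.Tactic.RingSolver using (solve-∀)
open import Data.Product.Base using (_×_; _,_; ∃-syntax; proj₁; proj₂)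
open import Data.Refinement.Base using (_,_; value)
open import Data.Sum.Base using (inj₁; inj₂)
open import Data.Vec.Functional using (Vector; insertAt; replicate)
open import Data.Vec.Functional.Properties using (insertAt-lookup; insertAt-punchIn)
open import Function.Base using (_∘_)
open import Relation.Binary.PropositionalEquality
open import Relation.Nullary.Decidable.Core using (yes; no)
open import Relation.Nullary.Decidable using (dec-true; dec-false)
open import Relation.Nullary.Negation.Core using (¬_; contradiction)
import Algebra.Properties.CommutativeMonoid.Sum +-0-commutativeMonoid as ℕΣ
import Algebra.Properties.CommutativeMonoid.Sum ℤ.+-0-commutativeMonoid as ℤΣ

-- Van der Waerden's theorem

-- The end y is the term after the l + 1 equally coloured ones; its colour is
-- unconstrained.
Progression : ∀ {r} → (ℕ → Fin r) → (l x y : ℕ) → Set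
Progression χ l x y =
  ∃[ d ] 0 < d × x + suc l * d ≡ y × (∀ j → j ≤ l → χ (x + j * d) ≡ χ x)

-- The bound `W` is uniform in `χ`, so that it can be fixed before the colouring: it serves as a
-- number of blocks in `fan-suc` and limits the difference in `chain`.
VanDerWaerden : (l r : ℕ) → Set
VanDerWaerden l r =
  ∃[ W ] ((χ : ℕ → Fin r) → ∃[ x ] ∃[ y ] y < W × Progression χ l x y)

-- Colour-focusing: the points g i are listed from newest to oldest, and each
-- is the end of a progression starting at any older one.  Once there are more
-- points than colours, some progression agrees in colour with its end.
IsFan : ∀ {r n} → (ℕ → Fin r) → (l N : ℕ) → (Fin n → ℕ) → Set
IsFan χ l N g =
  (∀ i → g i < N) × (∀ i j → i Fin.< j → Progression χ l (g j) (g i))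

Fan : (l r n : ℕ) → Set
Fan l r n = ∃[ N ] ((χ : ℕ → Fin r) → ∃[ g ] IsFan {n = n} χ l N g)

-- Numbers are grouped into blocks of length `N`, and a block is coloured by its word of `N`
-- colours. Van der Waerden for these `r ^ N` colours gives a progression of equally coloured
-- blocks, which repeat the fan found in the first one.
fan-suc : ∀ {l r s} → (∀ r → VanDerWaerden l r) → Fan l r (suc s) → Fan l r (suc (suc s))
fan-suc {l} {r} {s} vdW (N , fan) with vdW (r ^ N)
... | W , ap = W * N , extend
  where
  extend : ∀ χ → ∃[ g ] IsFan χ l (W * N) g
  extend χ with ap (λ b → funToFin {N} (λ i → χ (b * N + toℕ i)))
  ... | a , y , y<W , d , 0<d , refl , block with fan (λ i → χ (a * N + i))
  ... | g , g<N , aps = g′ , g′<WN , aps′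
    where
    same-block : ∀ {j} → j ≤ l → ∀ {i} → i < N →
                 χ ((a + j * d) * N + i) ≡ χ (a * N + i)
    same-block {j} j≤l i<N = subst (λ i → χ ((a + j * d) * N + i) ≡ χ (a * N + i))
      (toℕ-fromℕ< i<N)
      (trans (sym (finToFun-funToFin (λ i → χ ((a + j * d) * N + toℕ i)) (fromℕ< i<N)))
        (trans (cong (λ c → finToFun c (fromℕ< i<N)) (block _ j≤l))
          (finToFun-funToFin (λ i → χ (a * N + toℕ i)) (fromℕ< i<N))))

    -- The newest point is one step of d blocks beyond the last equally
    -- coloured copy of the old newest point, so that every old progression,
    -- with its difference enlarged by d * N, ends there.
    g′ : Fin (suc (suc s)) → ℕ
    g′ zero    = (a + suc l * d) * N + g zero
    g′ (suc i) = a * N + g i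

    in-block : ∀ {b i} → b < W → i < N → b * N + i < W * N
    in-block {b} {i} b<W i<N = begin-strict
      b * N + i  <⟨ +-monoʳ-< (b * N) i<N ⟩
      b * N + N  ≡⟨ +-comm (b * N) N ⟩
      suc b * N  ≤⟨ *-monoˡ-≤ N b<W ⟩
      W * N      ∎
      where open ≤-Reasoning

    g′<WN : ∀ i → g′ i < W * N
    g′<WN zero    = in-block y<W (g<N zero)
    g′<WN (suc i) = in-block (≤-<-trans (m≤m+n a (suc l * d)) y<W) (g<N i)

    instance
      N≢0 : NonZero N
      N≢0 = >-nonZero (≤-<-trans z≤n (g<N zero))

    shift : ∀ j x e → a * N + x + j * (d * N + e) ≡ (a + j * d) * N + (x + j * e)
    shift j x e = identity a N x j d e
      where
      identity : ∀ a N x j d e →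
        a * N + x + j * (d * N + e) ≡ (a + j * d) * N + (x + j * e)
      identity = solve-∀

    newest : ∀ x e → x + suc l * e ≡ g zero →
             (∀ j → j ≤ l → χ (a * N + (x + j * e)) ≡ χ (a * N + x)) →
             Progression χ l (a * N + x) (g′ zero)
    newest x e end mono =
      d * N + e , ≤-trans (*-mono-< {0} {d} {0} {N} 0<d (>-nonZero⁻¹ N)) (m≤m+n (d * N) e) ,
      trans (shift (suc l) x e) (cong (λ t → (a + suc l * d) * N + t) end) ,
      λ j j≤l → trans (cong χ (shift j x e))
        -- The offset `x + j * e` is at most the end `g zero`, hence still inside a block of length
        -- `N`.
        (trans (same-block j≤l (≤-<-trans (+-monoʳ-≤ x (*-monoˡ-≤ e (m≤n⇒m≤1+n j≤l)))
                                          (subst (_< N) (sym end) (g<N zero))))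
               (mono j j≤l))

    aps′ : ∀ i j → i Fin.< j → Progression χ l (g′ j) (g′ i)
    aps′ (suc i) (suc j) i<j with aps i j (s<s⁻¹ i<j)
    ... | e , 0<e , end , mono = e , 0<e ,
      trans (+-assoc (a * N) (g j) _) (cong (λ t → a * N + t) end) ,
      λ t t≤l → trans (cong χ (+-assoc (a * N) (g j) (t * e))) (mono t t≤l)
    -- Here `e = 0`: the copies of the old newest point themselves form a progression, of difference
    -- `d * N`.
    aps′ zero (suc zero) _ =
      newest (g zero) 0 (trans (cong (λ t → g zero + t) (*-zeroʳ (suc l))) (+-identityʳ _))
        (λ j _ → cong (λ z → χ (a * N + z))
                        (trans (cong (λ t → g zero + t) (*-zeroʳ j)) (+-identityʳ _)))
    aps′ zero (suc (suc j)) _ with aps zero (suc j) z<s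
    ... | e , _ , end , mono = newest (g (suc j)) e end mono

fan : ∀ {l} → (∀ r → VanDerWaerden l r) → ∀ r s → Fan l r (suc s)
fan vdW r zero    = 1 , λ χ → (λ _ → 0) , (λ _ → z<s) , λ { zero zero () }
fan vdW r (suc s) = fan-suc vdW (fan vdW r s)

vanDerWaerden : ∀ l r → VanDerWaerden l r
vanDerWaerden zero    r = 2 , λ χ → 0 , 1 , s<s z<s , 1 , z<s , refl , λ { _ z≤n → refl }
vanDerWaerden (suc l) r with fan (vanDerWaerden l) r r
-- The old end `g i` becomes the last equally coloured term, so the new end is `g i + d`; it is
-- below `N + N` because `d ≤ suc l * d ≤ g i < N`.
... | N , fans = N + N , λ χ → extract χ (fans χ)
  where
  extract : ∀ χ → ∃[ g ] IsFan {n = suc r} χ l N g →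
    ∃[ x ] ∃[ y ] y < N + N × Progression χ (suc l) x y
  extract χ (g , g<N , aps) with pigeonhole (n<1+n r) (χ ∘ g)
  ... | i , j , i<j , same with aps i j i<j
  ... | d , 0<d , end , mono = g j , _ , bound , d , 0<d , refl , mono′
    where
    bound : g j + suc (suc l) * d < N + N
    bound = begin-strict
      g j + (d + suc l * d)  ≡⟨ cong (λ t → g j + t) (+-comm d (suc l * d)) ⟩
      g j + (suc l * d + d)  ≡⟨ +-assoc (g j) (suc l * d) d ⟨
      g j + suc l * d + d    ≡⟨ cong (_+ d) end ⟩
      g i + d                ≤⟨ +-monoʳ-≤ (g i) (m≤m+n d (l * d)) ⟩
      g i + suc l * d        ≤⟨ +-monoʳ-≤ (g i) (m≤n+m (suc l * d) (g j)) ⟩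
      g i + (g j + suc l * d) ≡⟨ cong (λ t → g i + t) end ⟩
      g i + g i              <⟨ +-mono-< (g<N i) (g<N i) ⟩
      N + N                  ∎
      where open ≤-Reasoning

    mono′ : ∀ t → t ≤ suc l → χ (g j + t * d) ≡ χ (g j)
    mono′ t t≤1+l with m≤n⇒m<n∨m≡n t≤1+l
    ... | inj₁ t<1+l = mono t (s≤s⁻¹ t<1+l)
    ... | inj₂ refl  = trans (cong χ end) same

-- A Brauer-type theorem with a colour-dependent multiplier

f≤sum : ∀ {n} (f : Fin n → ℕ) i → f i ≤ ℕΣ.sum f
f≤sum {suc n} f i = ≤-trans (m≤m+n (f i) _) (≤-reflexive (sym (ℕΣ.sum-remove {i = i} f)))

-- Only the colour of z is missing for x, x + S w and z = q w to be monochromatic;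
-- S is evaluated at the colour of x.
Linked : ∀ {r} → ℕ → (Fin r → ℕ) → (ℕ → Fin r) → ℕ → ℕ → Set
Linked q S χ x z = ∃[ w ] z ≡ q * w × χ (x + S (χ x) * w) ≡ χ x

IsChain : ∀ {r s} → ℕ → (Fin r → ℕ) → (ℕ → Fin r) → ℕ → (Fin s → ℕ) → Set
IsChain q S χ N b = (∀ i → 0 < b i × b i ≤ N) ×
  (∀ i j → i Fin.< j → Linked q S χ (b i) (b j))

-- A progression supplies the first element and a difference `d`; the others come from a shorter
-- chain for the colouring that sends `x` to `χ (q * (d * x))`, scaled by `q * d`. As `sum S` bounds
-- `S` at every colour, the length can be chosen before the colour is known.
chain : ∀ {r} q .{{_ : NonZero q}} (S : Fin r → ℕ) s →
  ∃[ N ] ((χ : ℕ → Fin r) → ∃[ b ] IsChain {s = s} q S χ N b)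
chain q S zero = 0 , λ χ → (λ ()) , (λ ()) , λ ()
chain {r} q S (suc s) with chain q S s
... | N , chains with vanDerWaerden (ℕΣ.sum S * N) r
... | W , ap = W + q * (W * N) , extend
  where
  extend : ∀ χ → ∃[ b ] IsChain {s = suc s} q S χ (W + q * (W * N)) b
  -- Progressions may start at 0; the shift by `suc` makes the first element positive.
  extend χ with ap (χ ∘ suc)
  ... | a , y , y<W , d , 0<d , refl , mono with chains (λ x → χ (q * (d * x)))
  ... | b , b-bounds , links = b′ , b′-bounds , links′
    where
    -- The later elements q * w have w = d * b j with b j ≤ N, so S * w is a
    -- multiple of d small enough to stay in the progression starting at suc a.
    b′ : Fin (suc s) → ℕ
    b′ zero    = suc a
    b′ (suc i) = q * (d * b i)

    d≤W : d ≤ W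
    d≤W = ≤-trans (≤-trans (m≤m+n d _) (m≤n+m _ a)) (<⇒≤ y<W)

    b′-bounds : ∀ i → 0 < b′ i × b′ i ≤ W + q * (W * N)
    b′-bounds zero    = z<s , ≤-trans (≤-<-trans (m≤m+n a _) y<W) (m≤m+n W _)
    b′-bounds (suc i) with b-bounds i
    ... | 0<b , b≤N =
      *-mono-< {0} {q} {0} (>-nonZero⁻¹ q) (*-mono-< {0} {d} {0} 0<d 0<b) ,
      ≤-trans (*-monoʳ-≤ q (*-mono-≤ d≤W b≤N)) (m≤n+m _ W)

    links′ : ∀ i j → i Fin.< j → Linked q S χ (b′ i) (b′ j)
    links′ zero (suc j) _ with b-bounds j
    ... | _ , b≤N = d * b j , refl ,
      trans (cong (λ t → χ (suc a + t)) (identity (S (χ (suc a))) d (b j)))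
            (mono _ (*-mono-≤ (f≤sum S (χ (suc a))) b≤N))
      where
      identity : ∀ S d b → S * (d * b) ≡ S * b * d
      identity = solve-∀
    links′ (suc i) (suc j) i<j with links i j (s<s⁻¹ i<j)
    ... | w , eq , same = d * (q * w) , cong (λ z → q * (d * z)) eq ,
      trans (cong χ (identity q d (b i) (S (χ (b′ (suc i)))) w)) same
      where
      identity : ∀ q d x S w → q * (d * x) + S * (d * (q * w)) ≡ q * (d * (x + S * w))
      identity = solve-∀

-- By pigeonhole two of `suc r` chain elements share a colour, which is the equality that `Linked`
-- leaves open.
coloured-brauer : ∀ {r} q .{{_ : NonZero q}} (S : Fin r → ℕ) (χ : ℕ → Fin r) →
  ∃[ x ] ∃[ w ] 0 < x × 0 < w ×
    χ (x + S (χ x) * w) ≡ χ x × χ (q * w) ≡ χ x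
coloured-brauer {r} q S χ with chain q S (suc r)
... | _ , chains with chains χ
... | b , b-bounds , links with pigeonhole (n<1+n r) (χ ∘ b)
... | i , j , i<j , same with links i j i<j
... | w , eq , shifted = b i , w , proj₁ (b-bounds i) , 0<w , shifted ,
  trans (cong χ (sym eq)) (sym same)
  where
  0<w : 0 < w
  0<w = *-cancelˡ-< q 0 w
    (subst₂ _<_ (sym (*-zeroʳ q)) eq (proj₁ (b-bounds j)))

-- The coefficients and a candidate solution

powerCoeff-last : ∀ p n i → suc (toℕ i) ≡ n → powerCoeff p n i ≡ ℤ.- + (p ^ toℕ i)
powerCoeff-last p n i eq rewrite dec-true (suc (toℕ i) ≟ n) eq = refl

powerCoeff-init : ∀ p n i → suc (toℕ i) ≢ n → powerCoeff p n i ≡ + (p ^ toℕ i)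
powerCoeff-init p n i ne rewrite dec-false (suc (toℕ i) ≟ n) ne = refl

-- Divisibility ignores signs, so the valuation argument can treat the last term like the others.
∣powerCoeff∣ : ∀ p n i → ℤ.∣ powerCoeff p n i ∣ ≡ p ^ toℕ i
∣powerCoeff∣ p n i with suc (toℕ i) ≟ n
... | yes eq = trans (cong ℤ.∣_∣ (powerCoeff-last p n i eq)) (ℤ.∣-i∣≡∣i∣ (+ (p ^ toℕ i)))
... | no ne  = cong ℤ.∣_∣ (powerCoeff-init p n i ne)

toℕ-punchIn-fromℕ : ∀ {n} (i : Fin n) → toℕ (punchIn (fromℕ n) i) ≡ toℕ i
toℕ-punchIn-fromℕ zero    = refl
toℕ-punchIn-fromℕ (suc i) = cong suc (toℕ-punchIn-fromℕ i)

insertAt-all : ∀ {a ℓ} {A : Set a} (P : A → Set ℓ) {n} {xs : Vector A n} {x} →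
               P x → (∀ i → P (xs i)) → ∀ k i → P (insertAt xs k x i)
insertAt-all P         px pxs zero    zero    = px
insertAt-all P         px pxs zero    (suc i) = pxs i
insertAt-all P {suc n} px pxs (suc k) zero    = pxs zero
insertAt-all P {suc n} px pxs (suc k) (suc i) = insertAt-all P px (pxs ∘ suc) k i

sum-insertAt : ∀ {n} (c : Vector ℤ (suc n)) (xs : Vector ℕ⁺ n) k x →
  ℤΣ.sum (λ i → c i ℤ.* + value (insertAt xs k x i)) ≡
  c k ℤ.* + value x ℤ.+ ℤΣ.sum (λ i → c (punchIn k i) ℤ.* + value (xs i))
sum-insertAt c xs k x = trans
  (ℤΣ.sum-remove {i = k} (λ i → c i ℤ.* + value (insertAt xs k x i)))
  (cong₂ ℤ._+_
    (cong (λ y → c k ℤ.* + value y) (insertAt-lookup xs k x))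
    (ℤΣ.sum-cong-≗ λ i →
      cong (λ y → c (punchIn k i) ℤ.* + value y) (insertAt-punchIn xs k x i)))

sum-+-* : ∀ {n} (f : Vector ℕ n) z →
  ℤΣ.sum (λ i → + f i ℤ.* + z) ≡ + (ℕΣ.sum f * z)
sum-+-* {zero}  f z = refl
sum-+-* {suc n} f z = begin
  + f zero ℤ.* + z ℤ.+ ℤΣ.sum (λ i → + f (suc i) ℤ.* + z)
    ≡⟨ cong₂ ℤ._+_ (sym (ℤ.pos-* (f zero) z)) (sum-+-* (f ∘ suc) z) ⟩
  + (f zero * z) ℤ.+ + (ℕΣ.sum (f ∘ suc) * z)
    ≡⟨ ℤ.pos-+ (f zero * z) _ ⟨
  + (f zero * z + ℕΣ.sum (f ∘ suc) * z)
    ≡⟨ cong +_ (*-distribʳ-+ z (f zero) _) ⟨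
  + ((f zero + ℕΣ.sum (f ∘ suc)) * z) ∎
  where open ≡-Reasoning

rest : ∀ p {m} → Fin (suc m) → ℕ
rest p k = ℕΣ.sum (λ i → p ^ toℕ (punchIn k i))

-- Two nested insertions let `sum-insertAt` split off first the last term and then the term at `k`.
solution : ∀ {m} → Fin (suc m) → (x y z : ℕ⁺) → Vector ℕ⁺ (suc (suc m))
solution {m} k x y z = insertAt (insertAt (replicate m z) k x) (fromℕ (suc m)) y

solution-isSolution : ∀ p .{{_ : NonZero p}} {m} (k : Fin (suc m)) x y z →
  p ^ toℕ k * value x + rest p k * value z ≡ p ^ suc m * value y →
  IsSolution (powerEquation p (suc (suc m))) (solution k x y z)
solution-isSolution p {m} k x y z eq = begin
  ℤΣ.sum (λ i → c i ℤ.* + value (solution k x y z i))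
    ≡⟨ sum-insertAt c (insertAt (replicate m z) k x) (fromℕ (suc m)) y ⟩
  c (fromℕ (suc m)) ℤ.* + value y ℤ.+
    ℤΣ.sum (λ i → c (punchIn (fromℕ (suc m)) i) ℤ.* + value (insertAt (replicate m z) k x i))
    ≡⟨ cong₂ ℤ._+_ (cong (ℤ._* + value y) c-last)
         (ℤΣ.sum-cong-≗ λ i → cong (ℤ._* + value (insertAt (replicate m z) k x i)) (c-init i)) ⟩
  ℤ.- + (p ^ suc m) ℤ.* + value y ℤ.+
    ℤΣ.sum (λ i → + (p ^ toℕ i) ℤ.* + value (insertAt (replicate m z) k x i))
    ≡⟨ cong (λ t → ℤ.- + (p ^ suc m) ℤ.* + value y ℤ.+ t) init-sum ⟩
  ℤ.- + (p ^ suc m) ℤ.* + value y ℤ.+ + (p ^ suc m * value y)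
    ≡⟨ cong (λ t → t ℤ.+ + (p ^ suc m * value y))
         (trans (sym (ℤ.neg-distribˡ-* (+ (p ^ suc m)) (+ value y)))
                (cong ℤ.-_ (sym (ℤ.pos-* (p ^ suc m) (value y))))) ⟩
  ℤ.- + (p ^ suc m * value y) ℤ.+ + (p ^ suc m * value y)
    ≡⟨ ℤ.+-inverseˡ (+ (p ^ suc m * value y)) ⟩
  0ℤ ∎
  where
  open ≡-Reasoning
  c = powerCoeff p (suc (suc m))

  c-last : c (fromℕ (suc m)) ≡ ℤ.- + (p ^ suc m)
  c-last = trans (powerCoeff-last p _ (fromℕ (suc m)) (cong suc (toℕ-fromℕ (suc m))))
                 (cong (λ e → ℤ.- + (p ^ e)) (toℕ-fromℕ (suc m)))

  c-init : ∀ i → c (punchIn (fromℕ (suc m)) i) ≡ + (p ^ toℕ i)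
  c-init i = trans
    (powerCoeff-init p _ (punchIn (fromℕ (suc m)) i)
      λ eq → <⇒≢ (toℕ<n i) (trans (sym (toℕ-punchIn-fromℕ i)) (suc-injective eq)))
    (cong (λ e → + (p ^ e)) (toℕ-punchIn-fromℕ i))

  init-sum : ℤΣ.sum (λ i → + (p ^ toℕ i) ℤ.* + value (insertAt (replicate m z) k x i)) ≡
             + (p ^ suc m * value y)
  init-sum = begin
    ℤΣ.sum (λ i → + (p ^ toℕ i) ℤ.* + value (insertAt (replicate m z) k x i))
      ≡⟨ sum-insertAt (λ i → + (p ^ toℕ i)) (replicate m z) k x ⟩
    + (p ^ toℕ k) ℤ.* + value x ℤ.+ ℤΣ.sum (λ i → + (p ^ toℕ (punchIn k i)) ℤ.* + value z)
      ≡⟨ cong₂ ℤ._+_ (sym (ℤ.pos-* (p ^ toℕ k) (value x)))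
           (sum-+-* (λ i → p ^ toℕ (punchIn k i)) (value z)) ⟩
    + (p ^ toℕ k * value x) ℤ.+ + (rest p k * value z)
      ≡⟨ ℤ.pos-+ (p ^ toℕ k * value x) _ ⟨
    + (p ^ toℕ k * value x + rest p k * value z)
      ≡⟨ cong +_ eq ⟩
    + (p ^ suc m * value y) ∎

-- Regularity for n - 1 colours

-- The equation says k = m - (j - i) without subtraction, in the form that turns into an identity of
-- powers of `p`. The type of `k` keeps it away from the last variable.
Repetition : ∀ {m} → (Fin (suc m) → Fin m) → Set
Repetition {m} f = ∃[ i ] ∃[ j ] ∃[ k ] toℕ {m} k + toℕ j ≡ m + toℕ i × f i ≡ f j

repetition : ∀ {m} (f : Fin (suc m) → Fin m) → Repetition f
repetition {m} f with pigeonhole (n<1+n m) f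
... | i , j , i<j , eq = i , j , fromℕ< k<m , gap , eq
  where
  d = toℕ j ∸ toℕ i

  d≤m : d ≤ m
  d≤m = ≤-trans (m∸n≤m (toℕ j) (toℕ i)) (s≤s⁻¹ (toℕ<n j))

  k<m : m ∸ d < m
  k<m = ∸-monoʳ-< (m<n⇒0<n∸m i<j) d≤m

  gap : toℕ (fromℕ< k<m) + toℕ j ≡ m + toℕ i
  gap = begin
    toℕ (fromℕ< k<m) + toℕ j  ≡⟨ cong₂ _+_ (toℕ-fromℕ< k<m) (sym (m∸n+n≡m (<⇒≤ i<j))) ⟩
    m ∸ d + (d + toℕ i)       ≡⟨ +-assoc (m ∸ d) d (toℕ i) ⟨
    m ∸ d + d + toℕ i         ≡⟨ cong (_+ toℕ i) (m∸n+n≡m d≤m) ⟩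
    m + toℕ i                 ∎
    where open ≡-Reasoning

-- The junk value pos 0 is 1.
pos : ℕ → ℕ⁺
pos n = suc (pred n) , [ _ ]

value-pos : ∀ n .{{_ : NonZero n}} → value (pos n) ≡ n
value-pos (suc n) = refl

regular : ∀ p .{{_ : NonZero p}} m → Regular (suc m) (powerEquation p (suc (suc m)))
regular p m C =
  let x , w , 0<x , 0<w , same-y , same-z = coloured-brauer (p ^ M) {{m^n≢0 p M}} S χ
  in build (repetition (finToFun (χ x))) 0<x 0<w refl same-y same-z
  where
  M = suc m

  palette : ℕ → Fin (suc M) → Fin M
  palette x i = C (pos (p ^ toℕ i * x))

  χ : ℕ → Fin (M ^ suc M)
  χ x = funToFin (palette x)

  χ-≡ : ∀ {x c} → χ x ≡ c → ∀ i → palette x i ≡ finToFun c i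
  χ-≡ {x} eq i = trans (sym (finToFun-funToFin (palette x) i)) (cong (λ c → finToFun c i) eq)

  restOf : ∀ {f} → Repetition {M} f → ℕ
  restOf (_ , _ , k , _) = rest p k

  -- The repetition is sought in the decoded colour `c` rather than in a palette, so that `S` is a
  -- function of the colour alone.
  S : Fin (M ^ suc M) → ℕ
  S c = restOf (repetition (finToFun {M} {suc M} c))

  Goal : Set
  Goal = ∃[ X ] IsSolution (powerEquation p (suc M)) X × Monochromatic C X

  -- Abstracting over `rep` allows matching on it while `restOf rep` in the colour hypotheses
  -- reduces to `rest p k`.
  build : ∀ {x w c} (rep : Repetition (finToFun {M} {suc M} c)) → 0 < x → 0 < w →
          χ x ≡ c → χ (x + restOf rep * w) ≡ c → χ (p ^ M * w) ≡ c → Goal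
  build {x} {w} {c} (i , j , k , gap , eq) 0<x 0<w same-x same-y same-z =
    solution k X Y Z , solution-isSolution p k X Y Z equation ,
    λ s t → trans (coloured s) (sym (coloured t))
    where
    y = x + rest p k * w
    z = p ^ M * w
    X = pos (p ^ toℕ j * x)
    Y = pos (p ^ toℕ i * y)
    Z = pos (p ^ toℕ i * z)

    coloured : ∀ t → C (solution k X Y Z t) ≡ finToFun {M} {suc M} c i
    coloured = insertAt-all (λ v → C v ≡ _) (χ-≡ same-y i)
      (insertAt-all (λ v → C v ≡ _) (trans (χ-≡ same-x j) (sym eq)) (λ _ → χ-≡ same-z i) k)
      (fromℕ M)

    value-scaled : ∀ e {v} → 0 < v → value (pos (p ^ e * v)) ≡ p ^ e * v
    value-scaled e {v} 0<v = value-pos _ {{m*n≢0 (p ^ e) v {{m^n≢0 p e}} {{>-nonZero 0<v}}}}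

    0<z : 0 < z
    0<z = >-nonZero⁻¹ z {{m*n≢0 (p ^ M) w {{m^n≢0 p M}} {{>-nonZero 0<w}}}}

    equation : p ^ toℕ k * value X + rest p k * value Z ≡ p ^ M * value Y
    equation = begin
      p ^ toℕ k * value X + rest p k * value Z
        ≡⟨ cong₂ (λ a b → p ^ toℕ k * a + rest p k * b) (value-scaled (toℕ j) 0<x)
             (value-scaled (toℕ i) 0<z) ⟩
      p ^ toℕ k * (p ^ toℕ j * x) + rest p k * (p ^ toℕ i * z)
        ≡⟨ cong (_+ rest p k * (p ^ toℕ i * z)) (*-assoc (p ^ toℕ k) (p ^ toℕ j) x) ⟨
      p ^ toℕ k * p ^ toℕ j * x + rest p k * (p ^ toℕ i * z)
        ≡⟨ cong (λ a → a * x + rest p k * (p ^ toℕ i * z)) powers ⟩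
      p ^ M * p ^ toℕ i * x + rest p k * (p ^ toℕ i * z)
        ≡⟨ identity (p ^ M) (p ^ toℕ i) x (rest p k) w ⟩
      p ^ M * (p ^ toℕ i * y)
        ≡⟨ cong (p ^ M *_) (value-scaled (toℕ i) (≤-trans 0<x (m≤m+n x _))) ⟨
      p ^ M * value Y ∎
      where
      open ≡-Reasoning
      identity : ∀ P Q x S w → P * Q * x + S * (Q * (P * w)) ≡ P * (Q * (x + S * w))
      identity = solve-∀
      powers : p ^ toℕ k * p ^ toℕ j ≡ p ^ M * p ^ toℕ i
      powers = trans (sym (^-distribˡ-+-* p (toℕ k) (toℕ j)))
                     (trans (cong (p ^_) gap) (^-distribˡ-+-* p M (toℕ i)))

-- Valuations and failure for n colours

∣-sum : ∀ {d n} (f : Vector ℤ n) → (∀ i → d ∣ℤ f i) → d ∣ℤ ℤΣ.sum f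
∣-sum {n = zero}  f d∣f = ℤ∣.divides 0ℤ refl
∣-sum {n = suc n} f d∣f = ℤ∣.∣m∣n⇒∣m+n (d∣f zero) (∣-sum (f ∘ suc) (d∣f ∘ suc))

∣-sum-remaining : ∀ {d n} (f : Vector ℤ n) → ℤΣ.sum f ≡ 0ℤ → ∀ i →
                  (∀ j → j ≢ i → d ∣ℤ f j) → d ∣ℤ f i
∣-sum-remaining {d} {suc n} f sum≡0 i d∣others = ℤ∣.∣m+n∣n⇒∣m
  (subst (d ∣ℤ_) (trans (sym sum≡0) (ℤΣ.sum-remove {i = i} f)) (ℤ∣.divides 0ℤ refl))
  (∣-sum (f ∘ punchIn i) (λ j → d∣others (punchIn i j) (punchInᵢ≢i i j)))

^-monoʳ-∣ : ∀ p {m n} → m ≤ n → p ^ m ∣ p ^ n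
^-monoʳ-∣ p {m} m≤n with m≤n⇒∃[o]m+o≡n m≤n
... | o , refl = subst (p ^ m ∣_) (sym (^-distribˡ-+-* p m o)) (m∣m*n (p ^ o))

n<p^n : ∀ p .{{_ : NonTrivial p}} n → n < p ^ n
n<p^n p zero    = z<s
n<p^n p (suc n) = begin-strict
  suc n      ≤⟨ n<p^n p n ⟩
  p ^ n      <⟨ m<m*n (p ^ n) p {{m^n≢0 p n {{nonTrivial⇒nonZero p}}}} (nonTrivial⇒n>1 p) ⟩
  p ^ n * p  ≡⟨ *-comm (p ^ n) p ⟩
  p ^ suc n  ∎
  where open ≤-Reasoning

IsValuation : ℕ → ℕ → ℕ → Set
IsValuation p x e = p ^ e ∣ x × p ^ suc e ∤ x

-- A downward search from `b = x` keeps `p ^ b ∤ x` as invariant; it holds initially since `p ^ x`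
-- exceeds `x`.
valuation : ∀ p .{{_ : NonTrivial p}} x .{{_ : NonZero x}} → ∃[ e ] IsValuation p x e
valuation p x = below x (>⇒∤ (n<p^n p x))
  where
  below : ∀ b → p ^ b ∤ x → ∃[ e ] IsValuation p x e
  below zero    1∤x = contradiction (1∣ x) 1∤x
  below (suc b) ∤x with p ^ b ∣? x
  ... | yes ∣x = b , ∣x , ∤x
  ... | no ∤x′ = below b ∤x′

-- With `valuation-upper` this makes `i + e` the exact valuation of `p ^ i * x`.
valuation-lower : ∀ {p x e E} i → IsValuation p x e → E ≤ i + e → p ^ E ∣ p ^ i * x
valuation-lower {p} {x} {e} i (p^e∣x , _) E≤i+e = ∣-trans (^-monoʳ-∣ p E≤i+e)
  (subst (_∣ p ^ i * x) (sym (^-distribˡ-+-* p i e)) (*-monoʳ-∣ (p ^ i) p^e∣x))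

valuation-upper : ∀ {p x e E} .{{_ : NonZero p}} i → IsValuation p x e →
                  p ^ E ∣ p ^ i * x → E ≤ i + e
valuation-upper {p} {x} {e} {E} i (_ , p^1+e∤x) p^E∣ = ≮⇒≥ λ i+e<E →
  p^1+e∤x (*-cancelˡ-∣ (p ^ i) {{m^n≢0 p i}}
    (subst (_∣ p ^ i * x) (^-distribˡ-+-* p i (suc e))
      (∣-trans (^-monoʳ-∣ p (subst (_≤ E) (sym (+-suc i e)) i+e<E)) p^E∣)))

-- Removing the common residue of `a` and `b` leaves `i` and `j` congruent modulo `n`, and both are
-- below `n`.
+-cancel-% : ∀ {n} .{{_ : NonZero n}} {i j a b} → i < n → j < n →
             i + a ≡ j + b → a % n ≡ b % n → i ≡ j
+-cancel-% {n} {i} {j} {a} {b} i<n j<n eq a≡b = begin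
  i                          ≡⟨ m<n⇒m%n≡m i<n ⟨
  i % n                      ≡⟨ [m+kn]%n≡m%n i (a / n) n ⟨
  (i + a / n * n) % n        ≡⟨ cong (_% n) (+-cancelˡ-≡ (a % n) _ _ shifted) ⟩
  (j + b / n * n) % n        ≡⟨ [m+kn]%n≡m%n j (b / n) n ⟩
  j % n                      ≡⟨ m<n⇒m%n≡m j<n ⟩
  j                          ∎
  where
  open ≡-Reasoning
  swap : ∀ x y z → x + (y + z) ≡ y + (x + z)
  swap = solve-∀
  shifted : a % n + (i + a / n * n) ≡ a % n + (j + b / n * n)
  shifted = begin
    a % n + (i + a / n * n)  ≡⟨ swap (a % n) i (a / n * n) ⟩
    i + (a % n + a / n * n)  ≡⟨ cong (λ t → i + t) (m≡m%n+[m/n]*n a n) ⟨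
    i + a                    ≡⟨ eq ⟩
    j + b                    ≡⟨ cong (λ t → j + t) (m≡m%n+[m/n]*n b n) ⟩
    j + (b % n + b / n * n)  ≡⟨ swap (b % n) j (b / n * n) ⟨
    b % n + (j + b / n * n)  ≡⟨ cong (_+ (j + b / n * n)) a≡b ⟨
    a % n + (j + b / n * n)  ∎

valuation⁺ : ∀ p .{{_ : NonTrivial p}} (x : ℕ⁺) → ∃[ e ] IsValuation p (value x) e
valuation⁺ p (x , [ x≢0 ]) = valuation p x {{x≢0}}

¬regular : ∀ p .{{_ : NonZero p}} .{{_ : NonTrivial p}} m →
           ¬ Regular (suc m) (powerEquation p (suc m))
¬regular p m reg with reg (λ x → proj₁ (valuation⁺ p x) mod suc m)
... | X , sum≡0 , mono =
  -- At index `zero` the factor is `p ^ 0`, so divisibility by `p ^ suc (e zero)` contradicts the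
  -- valuation.
  <-irrefl refl (valuation-upper {x = value (X zero)} {e zero} zero (isVal zero)
    (divisible (suc (e zero)) zero))
  where
  e : Fin (suc m) → ℕ
  e i = proj₁ (valuation⁺ p (X i))

  isVal : ∀ i → IsValuation p (value (X i)) (e i)
  isVal i = proj₂ (valuation⁺ p (X i))

  e-% : ∀ i j → e i % suc m ≡ e j % suc m
  e-% i j = trans (sym (toℕ-fromℕ< (m%n<n (e i) (suc m))))
                  (trans (cong toℕ (mono i j)) (toℕ-fromℕ< (m%n<n (e j) (suc m))))

  distinct : ∀ i j → toℕ i + e i ≡ toℕ j + e j → i ≡ j
  distinct i j eq = toℕ-injective (+-cancel-% (toℕ<n i) (toℕ<n j) eq (e-% i j))

  term : Fin (suc m) → ℤ
  term i = powerCoeff p (suc m) i ℤ.* + value (X i)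

  ∣term∣ : ∀ i → ℤ.∣ term i ∣ ≡ p ^ toℕ i * value (X i)
  ∣term∣ i = trans (ℤ.abs-* (powerCoeff p (suc m) i) (+ value (X i)))
                   (cong (_* value (X i)) (∣powerCoeff∣ p (suc m) i))

  -- If `p ^ E` divides all terms, at most one has valuation exactly `E`, by `distinct`. All others
  -- are divisible by `p ^ suc E`, and so is this one because the sum vanishes.
  divisible : ∀ E i → p ^ E ∣ p ^ toℕ i * value (X i)
  divisible zero    i = 1∣ _
  divisible (suc E) i with E <? toℕ i + e i
  ... | yes E<i+e = valuation-lower (toℕ i) (isVal i) E<i+e
  ... | no E≮i+e  = subst (p ^ suc E ∣_) (∣term∣ i)
    (ℤ∣.∣⇒∣ᵤ {k = + (p ^ suc E)} (∣-sum-remaining term sum≡0 i others))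
    where
    E≤ : ∀ j → E ≤ toℕ j + e j
    E≤ j = valuation-upper (toℕ j) (isVal j) (divisible E j)

    E≡i+e : E ≡ toℕ i + e i
    E≡i+e = ≤-antisym (E≤ i) (≮⇒≥ E≮i+e)

    others : ∀ j → j ≢ i → + (p ^ suc E) ∣ℤ term j
    others j j≢i = ℤ∣.∣ᵤ⇒∣ (subst (p ^ suc E ∣_) (sym (∣term∣ j))
      (valuation-lower (toℕ j) (isVal j)
        (≤∧≢⇒< (E≤ j) λ E≡j+e → j≢i (distinct j i (trans (sym E≡j+e) E≡i+e)))))

theorem3p3 : ∀ (p : ℕ) (p-prime : Prime p) (n : ℕ) → n ≥ 2 →
    Regular (n ∸ 1) (powerEquation p {{prime⇒nonZero p-prime}} n) ×
    ¬ Regular n (powerEquation p {{prime⇒nonZero p-prime}} n)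
theorem3p3 p p-prime (suc (suc m)) _ =
  regular p {{prime⇒nonZero p-prime}} m ,
  ¬regular p {{prime⇒nonZero p-prime}} {{prime⇒nonTrivial p-prime}} (suc m)
theorem3p3 p p-prime (suc zero) (s≤s ())
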